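{- It is possible to compute in polynomial time, given any instance of $\textsc{Clique}$-$\textsc{Max}$, a solution $\tilde\mu$ such that $c(\tilde\mu)\le c^*+1$, where $c=\textsc{Max}$ is the measure of the problem and $c^*$ is the measure of an optimal solution.
   Context: An instance of $\textsc{Clique}$-$\textsc{Max}$ consists of a loop-free connected undirected graph $G=(V(G),E(G))$ on $n$ vertices, a set $P=\{1,\dots,k\}$ of pebbles, and a function $\sigma:P\to V(G)$ assigning each pebble its start vertex ($\sigma$ need not be injective). A (feasible) solution is a function $\mu:P\to V(G)$ (not necessarily injective), giving the end vertex of each pebble, such that the image $\mu[P]$ induces a clique in $G$ (every two distinct vertices of $\mu[P]$ are adjacent). The measure to be minimized is $\textsc{Max}(\mu)=\max_{p\in P}d_G(\sigma(p),\mu(p))$, where $d_G$ is the (unweighted) shortest path distance in $G$. -}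

module Defs where

open import Data.Bool.Base using (Bool; true; false; T)
open import Data.Bool.Properties using (T?)
open import Data.Empty using (⊥-elim)
open import Data.Fin.Base using (Fin; zero; suc; toℕ)
open import Data.Fin.Properties using (any?) renaming (_≟_ to _≟ᶠ_)
open import Data.List.Base using (List; []; _∷_; [_]; _++_; concat; length; map; replicate; tabulate)
open import Data.Maybe.Base using (Maybe; just; nothing)
open import Data.Nat.Base using (ℕ; zero; suc; _+_; _*_; _^_; _≤_; _⊔_; z≤n; s≤s)
open import Data.Product.Base using (Σ; ∃; _×_; _,_; proj₁)
import Data.Vec.Base as Vec
open Vec using (Vec; []; _∷_)
import Data.Vec.Functional as VecF
open import Relation.Binary.Core using (Rel)
open import Relation.Binary.Definitions using (Symmetric)
open import Relation.Binary.PropositionalEquality using (_≡_; _≢_; refl)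
open import Relation.Nullary using (Dec; yes; no; ¬_)
open import Relation.Nullary.Decidable using (map′; _×-dec_)
open import Relation.Unary using (Pred; Decidable; _∈_)
open import Level using (0ℓ)

------------------------------------------------------------------------
-- Graphs and shortest-path distance

record Graph (n : ℕ) : Set where
  field
    adjacent? : Fin n → Fin n → Bool

  Adj : Rel (Fin n) 0ℓ
  Adj u v = T (adjacent? u v)

  field
    symmetric : Symmetric Adj
    loop-free : ∀ u → ¬ Adj u u

  data Walk : Fin n → Fin n → ℕ → Set where
    []  : ∀ {u} → Walk u u 0
    _∷_ : ∀ {u w v m} → Adj u w → Walk w v m → Walk u v (suc m)

  Connected : Set
  Connected = ∀ u v → ∃ (Walk u v)

  IsClique : Pred (Fin n) 0ℓ → Set
  IsClique S = ∀ {u v} → u ∈ S → v ∈ S → u ≢ v → Adj u v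

  walk? : ∀ u v m → Dec (Walk u v m)
  walk? u v zero    = map′ (λ { refl → [] }) (λ { [] → refl }) (u ≟ᶠ v)
  walk? u v (suc m) = map′ (λ { (_ , e , p) → e ∷ p }) (λ { (e ∷ p) → _ , e , p })
                           (any? (λ w → T? (adjacent? u w) ×-dec walk? w v m))

Least : Pred ℕ 0ℓ → Pred ℕ 0ℓ
Least P m = P m × (∀ j → P j → m ≤ j)

least : ∀ {P : Pred ℕ 0ℓ} → Decidable P → ∀ n → P n → ∃ (Least P)
least P? zero    p = 0 , p , λ _ _ → z≤n
least P? (suc n) p with P? 0
... | yes p₀ = 0 , p₀ , λ _ _ → z≤n
... | no ¬p₀ with least (λ j → P? (suc j)) n p
...   | m , q , min = suc m , q , λ { zero p₀ → ⊥-elim (¬p₀ p₀) ; (suc j) pj → s≤s (min j pj) }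

------------------------------------------------------------------------
-- Clique-Max

record Instance : Set where
  field
    n         : ℕ
    graph     : Graph n
  open Graph graph public
  field
    connected : Connected
    k         : ℕ
    σ         : Fin k → Fin n

  shortest : ∀ u v → ∃ (Least (Walk u v))
  shortest u v with connected u v
  ... | m , p = least (walk? u v) m p

  dist : Fin n → Fin n → ℕ
  dist u v = proj₁ (shortest u v)

Image : ∀ {k n} → (Fin k → Fin n) → Pred (Fin n) 0ℓ
Image μ v = ∃ λ p → μ p ≡ v

record Solution (I : Instance) : Set where
  open Instance I
  field
    μ      : Fin k → Fin n
    clique : IsClique (Image μ)

-- The maximum over an empty set of pebbles is 0.
Max : (I : Instance) → Solution I → ℕ
Max I S = VecF.foldr _⊔_ 0 (λ p → dist (σ p) (μ p))
  where
  open Instance I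
  open Solution S

IsOptimal : (I : Instance) → Solution I → Set
IsOptimal I S = ∀ (S′ : Solution I) → Max I S ≤ Max I S′

------------------------------------------------------------------------
-- Deterministic multi-tape Turing machines

Word : Set
Word = List Bool

-- A tape cell; nothing is the blank.
Symbol : Set
Symbol = Maybe Bool

data Move : Set where
  goLeft stay goRight : Move

-- A two-way infinite tape. The head scans the first cell of `ahead`; `behind`
-- lists the cells to the left of the head, nearest first. All cells not listed
-- are blank.
record Tape : Set where
  constructor tape
  field
    behind ahead : List Symbol

read : Tape → Symbol
read (tape _ [])      = nothing
read (tape _ (x ∷ _)) = x

write : Symbol → Tape → Tape
write x (tape ls [])       = tape ls [ x ]
write x (tape ls (_ ∷ rs)) = tape ls (x ∷ rs)

move : Move → Tape → Tape
move stay    t                  = t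
move goLeft  (tape [] rs)       = tape [] (nothing ∷ rs)
move goLeft  (tape (l ∷ ls) rs) = tape ls (l ∷ rs)
move goRight (tape ls [])       = tape (nothing ∷ ls) []
move goRight (tape ls (r ∷ rs)) = tape (r ∷ ls) rs

-- Tape 0 is the input tape and tape 1 the output tape; both may be read and
-- written freely. A transition to nothing halts the machine.
record TM : Set where
  field
    #states #work : ℕ

  #tapes : ℕ
  #tapes = 2 + #work

  field
    start : Fin #states
    δ     : Fin #states → Vec Symbol #tapes →
            Maybe (Fin #states × Vec (Symbol × Move) #tapes)

  Config : Set
  Config = Fin #states × Vec Tape #tapes

  act : Symbol × Move → Tape → Tape
  act (x , d) t = move d (write x t)

  step : Config → Maybe Config
  step (q , ts) with δ q (Vec.map read ts)
  ... | nothing        = nothing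
  ... | just (q′ , as) = just (q′ , Vec.zipWith act as ts)

  -- HaltsIn c t c′: started in c, the machine halts in c′ after exactly t steps.
  data HaltsIn : Config → ℕ → Config → Set where
    halt : ∀ {c} → step c ≡ nothing → HaltsIn c 0 c
    next : ∀ {c c₁ c₂ t} → step c ≡ just c₁ → HaltsIn c₁ t c₂ → HaltsIn c (suc t) c₂

  blank : Tape
  blank = tape [] []

  initial : Word → Config
  initial x = start , tape [] (map just x) ∷ blank ∷ Vec.replicate #work blank

  untilBlank : List Symbol → Word
  untilBlank []             = []
  untilBlank (nothing ∷ _)  = []
  untilBlank (just b  ∷ xs) = b ∷ untilBlank xs

  -- The word from the head of the output tape up to the first blank.
  output : Config → Word
  output (_ , _ ∷ t ∷ _) = untilBlank (Tape.ahead t)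

  ComputesWithin : ℕ → Word → Word → Set
  ComputesWithin bound x y =
    ∃ λ t → ∃ λ c → HaltsIn (initial x) t c × output c ≡ y × t ≤ bound

-- One machine and one polynomial bound serve all instances: from the code of
-- a the machine produces the code of some b related to a. The behaviour on
-- words that encode no instance is unconstrained.
SolvableInPolyTime : {A : Set} {B : A → Set} →
                     (A → Word) → (∀ a → B a → Word) → (∀ a → B a → Set) → Set
SolvableInPolyTime encodeᴬ encodeᴮ R =
  Σ TM λ M → ∃ λ c → ∃ λ d → ∀ a → ∃ λ b →
    TM.ComputesWithin M (c * length (encodeᴬ a) ^ d + c) (encodeᴬ a) (encodeᴮ a b) × R a b

------------------------------------------------------------------------
-- Encodings

unary : ℕ → Word
unary m = replicate m true ++ [ false ]

encodePebbles : ∀ {k n} → (Fin k → Fin n) → Word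
encodePebbles f = concat (tabulate (λ p → unary (toℕ (f p))))

-- The number of vertices, the adjacency matrix row by row, the number of
-- pebbles, their start vertices. As the matrix already takes n² bits and the
-- pebbles at least k, writing numbers in unary rather than in binary changes
-- the length at most polynomially.
encodeInstance : Instance → Word
encodeInstance I =
  unary n ++ concat (tabulate (λ u → tabulate (adjacent? u))) ++
  unary k ++ encodePebbles σ
  where open Instance I

encodeSolution : (I : Instance) → Solution I → Word
encodeSolution I S = encodePebbles (Solution.μ S)

{-# OPTIONS --safe #-}
module Submission where

-- In a solution of measure c* any end vertex is adjacent or equal to all the
-- others, so every pebble is within c* + 1 of it. It therefore suffices to
-- gather all pebbles on a vertex v whose closed ball of radius r contains all
-- start vertices, for the least r ≥ 1 for which there is such a v; as distances
-- are less than n, r ≤ n.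
--
-- The machine grows the balls B(v, 1), …, B(v, r) afresh for each r and v, one
-- neighbourhood per scan of the input. It is written as a structured program
-- over seven tapes. A compiled program runs in polynomial time as soon as every
-- execution of each of its loops makes at most as many rounds as the input has
-- bits, which is all that has to be known about time.

open import Defs
open import Data.Bool.Base using (Bool; true; false; if_then_else_; _∧_; _∨_; not; T)
open import Data.Bool.Properties using (T-∧; T-∨; T-≡)
open import Data.Empty using (⊥-elim)
open import Data.Fin.Base using (Fin; zero; suc; toℕ; fromℕ<; splitAt; _↑ˡ_; _↑ʳ_)
open import Data.Fin.Properties
  using (splitAt-↑ˡ; splitAt-↑ʳ; toℕ<n; toℕ-injective; toℕ-fromℕ<; pigeonhole; ¬Fin0; _≟_)
open import Data.List.Base using (List; []; _∷_; [_]; _++_; _ʳ++_; concat; length; map; replicate; tabulate)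
open import Data.List.Properties
open import Data.Maybe.Base using (Maybe; just; nothing; fromMaybe)
open import Data.Nat.Base
open import Data.Nat.Properties hiding (_≟_)
open import Data.Nat.Properties using () renaming (_≟_ to _≟ⁿ_)
open import Data.Product.Base using (Σ; ∃; ∃₂; _×_; _,_; proj₁; proj₂)
open import Data.Sum.Base using (_⊎_; inj₁; inj₂)
open import Data.Unit.Base using (⊤; tt)
import Data.Vec.Base as Vec
open Vec using (Vec; []; _∷_; lookup; _[_]≔_)
import Data.Vec.Functional as VecF
open import Data.Vec.Properties as Vecₚ
  using (lookup-map; lookup∘update; []≔-idempotent; []≔-lookup; zipWith-replicate₁)
open import Data.Vec.Relation.Binary.Pointwise.Inductive as Pointwise using (Pointwise; []; _∷_)
open import Function.Base using (_∘_; case_of_)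
open import Function.Bundles using (Equivalence)
open import Relation.Binary.PropositionalEquality
  using (_≡_; refl; sym; trans; cong; cong₂; subst; subst₂; module ≡-Reasoning)
open import Relation.Nullary using (yes; no)

-- Structured programs over k tapes

hd : List Symbol → Symbol
hd []      = nothing
hd (x ∷ _) = x

tl : List Symbol → List Symbol
tl []       = []
tl (_ ∷ xs) = xs

-- Stacking a blank on blanks changes nothing, so a head that leaves a word to
-- the left and comes back finds the tape as it was.
infixr 5 _∷ᵇ_
_∷ᵇ_ : Symbol → List Symbol → List Symbol
nothing ∷ᵇ [] = []
nothing ∷ᵇ xs@(_ ∷ _) = nothing ∷ xs
just b ∷ᵇ xs = just b ∷ xs

scan : Tape → Symbol
scan (tape _ rs) = hd rs

-- An action that writes nothing leaves the tape literally unchanged, whereas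
-- act materialises the blank under the head.
Action : Set
Action = Maybe Symbol × Move

pattern keep = nothing , stay
pattern right = nothing , goRight
pattern left = nothing , goLeft

put : Maybe Symbol → Tape → Tape
put nothing  t = t
put (just x) (tape ls rs) = tape ls (x ∷ tl rs)

shift : Move → Tape → Tape
shift goLeft  (tape ls rs) = tape (tl ls) (hd ls ∷ rs)
shift stay    t            = t
shift goRight (tape ls rs) = tape (hd rs ∷ᵇ ls) (tl rs)

perform : Action → Tape → Tape
perform (w , d) t = shift d (put w t)

module _ (k : ℕ) where

  infixr 4 _⨾_
  data Cmd : Set where
    op    : (Vec Symbol k → Vec Action k) → Cmd
    _⨾_   : Cmd → Cmd → Cmd
    while : (Vec Symbol k → Bool) → Cmd → Cmd

module _ {k : ℕ} where

  scans : Vec Tape k → Vec Symbol k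
  scans = Vec.map scan

  performs : Vec Action k → Vec Tape k → Vec Tape k
  performs = Vec.zipWith perform

  -- Run X c ts ts′: the program c turns ts into ts′, and no execution of a loop
  -- makes more than X rounds.
  module _ (X : ℕ) where
    mutual
      data Run : Cmd k → Vec Tape k → Vec Tape k → Set where
        op    : ∀ {f ts} → Run (op f) ts (performs (f (scans ts)) ts)
        _⨾_   : ∀ {c d ts ts₁ ts₂} → Run c ts ts₁ → Run d ts₁ ts₂ → Run (c ⨾ d) ts ts₂
        while : ∀ {b c m ts ts′} → m ≤ X → Loop b c m ts ts′ → Run (while b c) ts ts′

      data Loop (b : Vec Symbol k → Bool) (c : Cmd k) : ℕ → Vec Tape k → Vec Tape k → Set where
        done  : ∀ {ts} → b (scans ts) ≡ false → Loop b c 0 ts ts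
        again : ∀ {m ts ts₁ ts₂} → b (scans ts) ≡ true → Run c ts ts₁ → Loop b c m ts₁ ts₂ →
                Loop b c (suc m) ts ts₂

  -- A loop of at most `X` rounds makes at most `suc X` tests, each taking one step and followed by
  -- at most one execution of the body.
  cost : Cmd k → ℕ → ℕ
  cost (op f)      X = 1
  cost (c ⨾ d)     X = cost c X + cost d X
  cost (while b c) X = suc X * suc (cost c X)

  -- Powers are taken of `suc X` so that they are positive and monotone in the exponent. A loop then
  -- raises the exponent by one, its tests being absorbed into the coefficient.
  cost-poly : ∀ c → ∃₂ λ a e → ∀ X → cost c X ≤ a * suc X ^ e
  cost-poly (op f) = 1 , 0 , λ X → ≤-refl
  cost-poly (c ⨾ d) with cost-poly c | cost-poly d
  ... | a₁ , e₁ , p₁ | a₂ , e₂ , p₂ = a₁ + a₂ , e₁ + e₂ , λ X → begin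
    cost c X + cost d X                                     ≤⟨ +-mono-≤ (p₁ X) (p₂ X) ⟩
    a₁ * suc X ^ e₁ + a₂ * suc X ^ e₂                       ≤⟨ +-mono-≤ (*-monoʳ-≤ a₁ (^-monoʳ-≤ (suc X) (m≤m+n e₁ e₂)))
                                                                        (*-monoʳ-≤ a₂ (^-monoʳ-≤ (suc X) (m≤n+m e₂ e₁))) ⟩
    a₁ * suc X ^ (e₁ + e₂) + a₂ * suc X ^ (e₁ + e₂)         ≡⟨ *-distribʳ-+ (suc X ^ (e₁ + e₂)) a₁ a₂ ⟨
    (a₁ + a₂) * suc X ^ (e₁ + e₂)                           ∎
    where open ≤-Reasoning
  cost-poly (while b c) with cost-poly c
  ... | a , e , p = suc a , suc e , λ X → begin
    suc X * suc (cost c X)              ≤⟨ *-monoʳ-≤ (suc X) (+-mono-≤ (m^n>0 (suc X) e) (p X)) ⟩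
    suc X * (suc a * suc X ^ e)         ≡⟨ *-assoc (suc X) (suc a) (suc X ^ e) ⟨
    suc X * suc a * suc X ^ e           ≡⟨ cong (_* suc X ^ e) (*-comm (suc X) (suc a)) ⟩
    suc a * suc X * suc X ^ e           ≡⟨ *-assoc (suc a) (suc X) (suc X ^ e) ⟩
    suc a * suc X ^ suc e               ∎
    where open ≤-Reasoning

  -- Compilation: in next, the control point nothing is the exit.

  -- In a loop, `nothing` is the point where the condition is tested, to which the body returns on
  -- its exit.
  Point : Cmd k → Set
  Point (op f)      = ⊤
  Point (c ⨾ d)     = Point c ⊎ Point d
  Point (while b c) = Maybe (Point c)

  entry : ∀ c → Point c
  entry (op f)      = tt
  entry (c ⨾ d)     = inj₁ (entry c)
  entry (while b c) = nothing

  idle : Vec Action k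
  idle = Vec.replicate k keep

  next : ∀ c → Point c → Vec Symbol k → Maybe (Point c) × Vec Action k
  next (op f) tt ss = nothing , f ss
  next (c ⨾ d) (inj₁ q) ss with next c q ss
  ... | just q′ , as = just (inj₁ q′) , as
  ... | nothing , as = just (inj₂ (entry d)) , as
  next (c ⨾ d) (inj₂ q) ss with next d q ss
  ... | just q′ , as = just (inj₂ q′) , as
  ... | nothing , as = nothing , as
  next (while b c) nothing ss with b ss
  ... | true  = just (just (entry c)) , idle
  ... | false = nothing , idle
  next (while b c) (just q) ss with next c q ss
  ... | just q′ , as = just (just q′) , as
  ... | nothing , as = just nothing , as

  data Steps (c : Cmd k) : Point c → Vec Tape k → ℕ → Vec Tape k → Set where
    exit : ∀ {q ts as} → next c q (scans ts) ≡ (nothing , as) → Steps c q ts 1 (performs as ts)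
    more : ∀ {q q′ ts as t ts′} → next c q (scans ts) ≡ (just q′ , as) →
           Steps c q′ (performs as ts) t ts′ → Steps c q ts (suc t) ts′

  performs-idle : ∀ ts → performs idle ts ≡ ts
  performs-idle ts = trans (zipWith-replicate₁ perform keep ts) (Vecₚ.map-id ts)

  -- The `next` of a compound is stuck on a `with` over the `next` of its part. Here and in the
  -- following lemmas, `helper` rewrites by the known transition to release it.
  steps-inj₂ : ∀ {c d q ts t ts′} → Steps d q ts t ts′ → Steps (c ⨾ d) (inj₂ q) ts t ts′
  steps-inj₂ {c} {d} (exit {q} {ts} e) = exit (helper e)
    where
    helper : ∀ {as} → next d q (scans ts) ≡ (nothing , as) → next (c ⨾ d) (inj₂ q) (scans ts) ≡ (nothing , as)
    helper e rewrite e = refl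
  steps-inj₂ {c} {d} (more {q} {q′} {ts} e s) = more (helper e) (steps-inj₂ s)
    where
    helper : ∀ {as} → next d q (scans ts) ≡ (just q′ , as) → next (c ⨾ d) (inj₂ q) (scans ts) ≡ (just (inj₂ q′) , as)
    helper e rewrite e = refl

  steps-⨾ : ∀ {c d q ts t ts₁ t′ ts₂} → Steps c q ts t ts₁ → Steps d (entry d) ts₁ t′ ts₂ →
            Steps (c ⨾ d) (inj₁ q) ts (t + t′) ts₂
  steps-⨾ {c} {d} (exit {q} {ts} e) s = more (helper e) (steps-inj₂ s)
    where
    helper : ∀ {as} → next c q (scans ts) ≡ (nothing , as) →
             next (c ⨾ d) (inj₁ q) (scans ts) ≡ (just (inj₂ (entry d)) , as)
    helper e rewrite e = refl
  steps-⨾ {c} {d} (more {q} {q′} {ts} e r) s = more (helper e) (steps-⨾ r s)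
    where
    helper : ∀ {as} → next c q (scans ts) ≡ (just q′ , as) →
             next (c ⨾ d) (inj₁ q) (scans ts) ≡ (just (inj₁ q′) , as)
    helper e rewrite e = refl

  steps-while : ∀ {b c q ts t ts₁ t′ ts₂} → Steps c q ts t ts₁ → Steps (while b c) nothing ts₁ t′ ts₂ →
                Steps (while b c) (just q) ts (t + t′) ts₂
  steps-while {b} {c} (exit {q} {ts} e) s = more (helper e) s
    where
    helper : ∀ {as} → next c q (scans ts) ≡ (nothing , as) →
             next (while b c) (just q) (scans ts) ≡ (just nothing , as)
    helper e rewrite e = refl
  steps-while {b} {c} (more {q} {q′} {ts} e r) s = more (helper e) (steps-while r s)
    where
    helper : ∀ {as} → next c q (scans ts) ≡ (just q′ , as) →
             next (while b c) (just q) (scans ts) ≡ (just (just q′) , as)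
    helper e rewrite e = refl

  -- The test performs `idle`, which leaves the tapes as they were only propositionally; hence the
  -- transport.
  steps-done : ∀ {b c ts} → b (scans ts) ≡ false → Steps (while b c) nothing ts 1 ts
  steps-done {b} {c} {ts} e = subst (Steps (while b c) nothing ts 1) (performs-idle ts) (exit helper)
    where
    helper : next (while b c) nothing (scans ts) ≡ (nothing , idle)
    helper rewrite e = refl

  steps-again : ∀ {b c ts t ts′} → b (scans ts) ≡ true → Steps (while b c) (just (entry c)) ts t ts′ →
                Steps (while b c) nothing ts (suc t) ts′
  steps-again {b} {c} {ts} {t} {ts′} e s =
    more helper (subst (λ us → Steps (while b c) _ us t ts′) (sym (performs-idle ts)) s)
    where
    helper : next (while b c) nothing (scans ts) ≡ (just (just (entry c)) , idle)
    helper rewrite e = refl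

  mutual
    run-steps : ∀ {X c ts ts′} → Run X c ts ts′ → ∃ λ t → Steps c (entry c) ts t ts′ × t ≤ cost c X
    run-steps op = 1 , exit refl , ≤-refl
    run-steps (r ⨾ r′) with run-steps r | run-steps r′
    ... | _ , s , p | _ , s′ , p′ = _ , steps-⨾ s s′ , +-mono-≤ p p′
    run-steps {X} {while b c} (while m≤X l) with loop-steps l
    ... | _ , s , p = _ , s , ≤-trans p (*-monoˡ-≤ (suc (cost c X)) (s≤s m≤X))

    loop-steps : ∀ {X b c m ts ts′} → Loop X b c m ts ts′ →
                 ∃ λ t → Steps (while b c) nothing ts t ts′ × t ≤ suc m * suc (cost c X)
    loop-steps (done e) = 1 , steps-done e , s≤s z≤n
    loop-steps (again e r l) with run-steps r | loop-steps l
    ... | _ , s , p | _ , s′ , p′ = _ , steps-again e (steps-while s s′) , s≤s (+-mono-≤ p p′)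

  -- Control points as numbered states

  size : Cmd k → ℕ
  size (op f)      = 1
  size (c ⨾ d)     = size c + size d
  size (while b c) = suc (size c)

  code : ∀ c → Point c → Fin (size c)
  code (op f)      tt       = zero
  code (c ⨾ d)     (inj₁ q) = code c q ↑ˡ size d
  code (c ⨾ d)     (inj₂ q) = size c ↑ʳ code d q
  code (while b c) nothing  = zero
  code (while b c) (just q) = suc (code c q)

  decode : ∀ c → Fin (size c) → Point c
  decode (op f)      _       = tt
  decode (c ⨾ d)     i       with splitAt (size c) i
  ... | inj₁ j = inj₁ (decode c j)
  ... | inj₂ j = inj₂ (decode d j)
  decode (while b c) zero    = nothing
  decode (while b c) (suc i) = just (decode c i)

  -- The machine finds its transition by decoding its state, so this makes the state `code c q` act
  -- as the point `q`.
  decode-code : ∀ c q → decode c (code c q) ≡ q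
  decode-code (op f)      tt       = refl
  decode-code (c ⨾ d)     (inj₁ q) rewrite splitAt-↑ˡ (size c) (code c q) (size d) = cong inj₁ (decode-code c q)
  decode-code (c ⨾ d)     (inj₂ q) rewrite splitAt-↑ʳ (size c) (size d) (code d q) = cong inj₂ (decode-code d q)
  decode-code (while b c) nothing  = refl
  decode-code (while b c) (just q) = cong just (decode-code c q)

-- Tapes up to trailing blanks

cell : List Symbol → ℕ → Symbol
cell []       _       = nothing
cell (x ∷ _)  zero    = x
cell (_ ∷ xs) (suc i) = cell xs i

infix 4 _≋_ _≈_
-- A record rather than a plain function type, so that the lists can be inferred from a proof.
record _≋_ (xs ys : List Symbol) : Set where
  constructor pointwise
  field cells : ∀ i → cell xs i ≡ cell ys i
open _≋_

record _≈_ (t u : Tape) : Set where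
  constructor _,_
  field
    behind-≋ : Tape.behind t ≋ Tape.behind u
    ahead-≋  : Tape.ahead t ≋ Tape.ahead u

≋-trans : ∀ {xs ys zs} → xs ≋ ys → ys ≋ zs → xs ≋ zs
≋-trans p q .cells i = trans (cells p i) (cells q i)

hd-cell : ∀ xs → hd xs ≡ cell xs 0
hd-cell []      = refl
hd-cell (_ ∷ _) = refl

tl-cell : ∀ xs i → cell (tl xs) i ≡ cell xs (suc i)
tl-cell []      _ = refl
tl-cell (_ ∷ _) _ = refl

hd-cong : ∀ {xs ys} → xs ≋ ys → hd xs ≡ hd ys
hd-cong {xs} {ys} e = trans (hd-cell xs) (trans (cells e 0) (sym (hd-cell ys)))

tl-cong : ∀ {xs ys} → xs ≋ ys → tl xs ≋ tl ys
tl-cong {xs} {ys} e .cells i = trans (tl-cell xs i) (trans (cells e (suc i)) (sym (tl-cell ys i)))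

∷-cong : ∀ {x y xs ys} → x ≡ y → xs ≋ ys → x ∷ xs ≋ y ∷ ys
∷-cong x≡y e .cells zero    = x≡y
∷-cong x≡y e .cells (suc i) = cells e i

∷≋∷ᵇ : ∀ x xs → x ∷ xs ≋ x ∷ᵇ xs
∷≋∷ᵇ nothing  []      .cells zero    = refl
∷≋∷ᵇ nothing  []      .cells (suc i) = refl
∷≋∷ᵇ nothing  (_ ∷ _) .cells i       = refl
∷≋∷ᵇ (just b) xs      .cells i       = refl

hd-∷-tl : ∀ xs → hd xs ∷ tl xs ≋ xs
hd-∷-tl []       .cells zero    = refl
hd-∷-tl []       .cells (suc i) = refl
hd-∷-tl (x ∷ xs) .cells i       = refl

write-tl : ∀ x t → write x t ≡ tape (Tape.behind t) (x ∷ tl (Tape.ahead t))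
write-tl x (tape ls [])      = refl
write-tl x (tape ls (_ ∷ _)) = refl

-- `move` stacks a blank literally where `shift` may drop it, but the cells of both stacks agree.
move-≈ : ∀ d {t u} → t ≈ u → move d t ≈ shift d u
move-≈ stay e = e
move-≈ goLeft  {tape []       rs} (p , q) = tl-cong p , ∷-cong (hd-cong p) q
move-≈ goLeft  {tape (l ∷ ls) rs} (p , q) = tl-cong p , ∷-cong (hd-cong p) q
move-≈ goRight {tape ls []}       (p , q) = ≋-trans (∷-cong (hd-cong q) p) (∷≋∷ᵇ _ _) , tl-cong q
move-≈ goRight {tape ls (r ∷ rs)} (p , q) = ≋-trans (∷-cong (hd-cong q) p) (∷≋∷ᵇ _ _) , tl-cong q

-- With nothing to write, the machine writes back the scanned symbol. Beyond the listed cells this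
-- adds a blank, which `≋` does not see.
put-≈ : ∀ w {t u} → t ≈ u → write (fromMaybe (scan u) w) t ≈ put w u
put-≈ (just x) {t} (p , q) rewrite write-tl x t = p , ∷-cong refl (tl-cong q)
put-≈ nothing {t} {tape _ rs} (p , q) rewrite write-tl (hd rs) t =
  p , ≋-trans (∷-cong refl (tl-cong q)) (hd-∷-tl rs)

read-≈ : ∀ {t u} → t ≈ u → read t ≡ scan u
read-≈ {tape _ []}      (_ , q) = hd-cong q
read-≈ {tape _ (_ ∷ _)} (_ , q) = hd-cong q

-- The Turing machine of a program

realise : Action → Symbol → Symbol × Move
realise (w , d) s = fromMaybe s w , d

module Machine {m : ℕ} (c : Cmd (2 + m)) where

  -- State zero has no transitions: it is the halting state, reached on exit.
  label : Maybe (Point c) → Fin (suc (size c))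
  label nothing  = zero
  label (just q) = suc (code c q)

  response : Maybe (Point c) × Vec Action (2 + m) → Vec Symbol (2 + m) →
             Fin (suc (size c)) × Vec (Symbol × Move) (2 + m)
  response (q , as) ss = label q , Vec.zipWith realise as ss

  machine : TM
  machine = record
    { #states = suc (size c)
    ; #work   = m
    ; start   = label (just (entry c))
    ; δ       = λ
      { zero    _  → nothing
      ; (suc i) ss → just (response (next c (decode c i) ss) ss) }
    }

  open TM machine using (act; step; HaltsIn; halt; initial; output; untilBlank; ComputesWithin)

  reads-≈ : ∀ {k} {ts us : Vec Tape k} → Pointwise _≈_ ts us → Vec.map read ts ≡ Vec.map scan us
  reads-≈ []       = refl
  reads-≈ (e ∷ es) = cong₂ _∷_ (read-≈ e) (reads-≈ es)

  acts-≈ : ∀ {k} {ts us : Vec Tape k} (as : Vec Action k) → Pointwise _≈_ ts us →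
           Pointwise _≈_ (Vec.zipWith act (Vec.zipWith realise as (Vec.map scan us)) ts)
                         (Vec.zipWith perform as us)
  acts-≈ []             []       = []
  acts-≈ ((w , d) ∷ as) (e ∷ es) = move-≈ d (put-≈ w e) ∷ acts-≈ as es

  step-response : ∀ {q q′ as ts us} → Pointwise _≈_ ts us → next c q (scans us) ≡ (q′ , as) →
                  step (label (just q) , ts) ≡
                  just (label q′ , Vec.zipWith act (Vec.zipWith realise as (scans us)) ts)
  step-response {q} es e rewrite decode-code c q | reads-≈ es | e = refl

  -- Tapes are simulated only up to `≈`, but steps correspond one to one, so `t` carries over; the
  -- exit step leads to the halting state.
  steps-halts : ∀ {q us t us′ ts} → Steps c q us t us′ → Pointwise _≈_ ts us →
                ∃ λ ts′ → HaltsIn (label (just q) , ts) t (label nothing , ts′) × Pointwise _≈_ ts′ us′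
  steps-halts (exit {as = as} e) es = _ , TM.next (step-response es e) (halt refl) , acts-≈ as es
  steps-halts (more {as = as} e s) es with steps-halts s (acts-≈ as es)
  ... | _ , h , es′ = _ , TM.next (step-response es e) h , es′

  ≈-refl : ∀ {t} → t ≈ t
  ≈-refl = pointwise (λ _ → refl) , pointwise (λ _ → refl)

  -- After the word the list either ends or shows a blank, and `untilBlank` stops in both cases.
  untilBlank-word : ∀ w {xs} → xs ≋ map just w → untilBlank xs ≡ w
  untilBlank-word [] {[]} e = refl
  untilBlank-word [] {x ∷ xs} e with cells e 0
  ... | refl = refl
  untilBlank-word (b ∷ w) {[]} e with cells e 0
  ... | ()
  untilBlank-word (b ∷ w) {x ∷ xs} e with cells e 0
  ... | refl = cong (b ∷_) (untilBlank-word w (tl-cong e))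

  initialᵃ : Word → Vec Tape (2 + m)
  initialᵃ x = tape [] (map just x) ∷ Vec.replicate (suc m) (tape [] [])

  initial-≈ : ∀ x → Pointwise _≈_ (proj₂ (initial x)) (initialᵃ x)
  initial-≈ x = ≈-refl ∷ Pointwise.refl ≈-refl

  computes : ∀ {X x i ls y us} → Run X c (initialᵃ x) (i ∷ tape ls (map just y) ∷ us) →
             ComputesWithin (cost c X) x y
  computes {x = x} r with run-steps r
  ... | t , s , t≤ with steps-halts s (initial-≈ x)
  ...   | _ ∷ _ ∷ _ , h , _ ∷ (_ , q) ∷ _ = t , _ , h , untilBlank-word _ q , t≤

-- Polynomial time bounds

^-distrib-* : ∀ e m n → (m * n) ^ e ≡ m ^ e * n ^ e
^-distrib-* zero    m n = refl
^-distrib-* (suc e) m n = trans (cong (m * n *_) (^-distrib-* e m n))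
                                ([m*n]*[o*p]≡[m*o]*[n*p] m n (m ^ e) (n ^ e))

module _ {A : Set} {B : A → Set} {encodeᴬ : A → Word} {encodeᴮ : ∀ a → B a → Word} {R : ∀ a → B a → Set} where

  -- As codes are nonempty, `suc L` is at most `2 * L`, so a bound in powers of `suc L` becomes one
  -- in powers of `L` at the price of the factor `2 ^ e`.
  solvable : ∀ {m} (c : Cmd (2 + m)) → (∀ a → 0 < length (encodeᴬ a)) →
             (∀ a → ∃ λ b → R a b × ∃₂ λ i ls → ∃ λ us →
               Run (length (encodeᴬ a)) c (Machine.initialᵃ c (encodeᴬ a))
                   (i ∷ tape ls (map just (encodeᴮ a b)) ∷ us)) →
             SolvableInPolyTime encodeᴬ encodeᴮ R
  solvable c pos run with cost-poly c
  ... | a , e , p = Machine.machine c , a * 2 ^ e , e , λ x →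
    let b , holds , _ , _ , _ , r = run x
        t , c′ , h , out , t≤ = Machine.computes c r
    in b , (t , c′ , h , out , ≤-trans t≤ (bound (length (encodeᴬ x)) (pos x))) , holds
    where
    open ≤-Reasoning
    bound : ∀ L → 0 < L → cost c L ≤ a * 2 ^ e * L ^ e + a * 2 ^ e
    bound L 0<L = begin
      cost c L                            ≤⟨ p L ⟩
      a * suc L ^ e                       ≤⟨ *-monoʳ-≤ a (^-monoˡ-≤ e (+-monoˡ-≤ L 0<L)) ⟩
      a * (L + L) ^ e                     ≡⟨ cong (λ z → a * (L + z) ^ e) (+-identityʳ L) ⟨
      a * (2 * L) ^ e                     ≡⟨ cong (a *_) (^-distrib-* e 2 L) ⟩
      a * (2 ^ e * L ^ e)                 ≡⟨ *-assoc a (2 ^ e) (L ^ e) ⟨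
      a * 2 ^ e * L ^ e                   ≤⟨ m≤m+n _ _ ⟩
      a * 2 ^ e * L ^ e + a * 2 ^ e       ∎

-- Gathering at a center

-- A blank counts as neither bit, so that a loop seeking past equal bits stops at the end of the
-- word.
is : Bool → Symbol → Bool
is _     nothing      = false
is true  (just b)     = b
is false (just b)     = not b

bit? : Symbol → Bool
bit? nothing  = false
bit? (just _) = true

-- HOT: candidate center, one-hot; OLD, NEW: sets of vertices, as bit vectors;
-- RAD: radius, unary; OK: whether the last set computed contains all pebbles.
pattern IN  = zero
pattern OUT = suc zero
pattern HOT = suc (suc zero)
pattern OLD = suc (suc (suc zero))
pattern NEW = suc (suc (suc (suc zero)))
pattern RAD = suc (suc (suc (suc (suc zero))))
pattern OK  = suc (suc (suc (suc (suc (suc zero)))))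

module _ {k : ℕ} where

  _at_ : {A : Set} → (Symbol → A) → Fin k → Vec Symbol k → A
  (f at i) ss = f (lookup ss i)

  on : Fin k → Action → Cmd k
  on i a = op (λ _ → idle [ i ]≔ a)

  -- The first step left precedes the test, since the head may stand on the blank after the word.
  -- The loop ends on the blank before the word.
  rewind : Fin k → Cmd k
  rewind i = on i left ⨾ while (bit? at i) (on i left) ⨾ on i right

  seek : Bool → Fin k → Cmd k
  seek b i = while (is b at i) (on i right)

skip : Cmd 7
skip = seek true IN ⨾ on IN right

copyBit : Fin 7 → Fin 7 → Cmd 7
copyBit i j = op λ ss → idle [ i ]≔ right [ j ]≔ (just (lookup ss i) , goRight)

copy : Fin 7 → Fin 7 → Cmd 7
copy i j = while (bit? at i) (copyBit i j)

-- The head of `OLD` rests on the bit of the vertex whose row is being read, while those of `IN` and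
-- `NEW` run along the columns.
spreadBit : Cmd 7
spreadBit = op λ ss →
  idle [ IN ]≔ right
       [ NEW ]≔ (just (just ((is true at NEW) ss ∨ ((is true at IN) ss ∧ (is true at OLD) ss))) , goRight)

spreadRow : Cmd 7
spreadRow = while (bit? at NEW) spreadBit

spreadAll : Cmd 7
spreadAll = while (bit? at OLD) (spreadRow ⨾ rewind NEW ⨾ on OLD right)

advance : Cmd 7
advance = op λ _ → idle [ IN ]≔ right [ NEW ]≔ right

-- The ones of a start vertex in unary move the head of `NEW` to the bit of that vertex, which is
-- then conjoined to `OK`.
checkOne : Cmd 7
checkOne = while (is true at IN) advance
         ⨾ (op λ ss → idle [ IN ]≔ right [ OK ]≔ (just (just ((is true at OK) ss ∧ (is true at NEW) ss)) , stay))
         ⨾ rewind NEW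

checkAll : Cmd 7
checkAll = while (bit? at IN) checkOne

-- Replaces the set on NEW by its closed neighbourhood.
pass : Cmd 7
pass = copy NEW OLD ⨾ rewind OLD ⨾ rewind NEW
     ⨾ skip ⨾ spreadAll ⨾ rewind OLD
     ⨾ skip ⨾ on OK (just (just true) , stay) ⨾ checkAll ⨾ rewind IN

-- HOT holds zeros with its head on the vertex under test. On success the vertex
-- stays marked by a one.
try : Cmd 7
try = on HOT (just (just true) , stay) ⨾ rewind HOT ⨾ copy HOT NEW ⨾ rewind HOT ⨾ rewind NEW
    ⨾ while (bit? at RAD) (pass ⨾ on RAD right) ⨾ rewind RAD
    ⨾ seek false HOT
    ⨾ op (λ ss → idle [ HOT ]≔ (just (lookup ss OK) , (if (is true at OK) ss then stay else goRight)))

tryAll : Cmd 7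
tryAll = while (λ ss → (is false at OK) ss ∧ (bit? at HOT) ss) try

-- The radius grows by a one written to the left of `RAD`, which leaves the head at the beginning of
-- the word. The successful round does this too, as the condition is tested only between rounds.
search : Cmd 7
search = while (is false at OK)
  (tryAll ⨾ rewind HOT ⨾ on RAD left ⨾ on RAD (just (just true) , stay))

appendZero : Cmd 7
appendZero = op λ _ → idle [ IN ]≔ right [ HOT ]≔ zero-right [ OLD ]≔ zero-right [ NEW ]≔ zero-right
  where zero-right = just (just false) , goRight

-- Without vertices OK is set at once, so that the search is skipped.
setup : Cmd 7
setup = while (is true at IN) appendZero
      ⨾ rewind HOT ⨾ rewind OLD ⨾ rewind NEW ⨾ rewind IN
      ⨾ op (λ ss → idle [ OUT ]≔ left [ RAD ]≔ (just (just true) , stay)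
                        [ OK ]≔ (just (just (not ((bit? at HOT) ss))) , stay))

-- The output is written from right to left.
emitTrue : Cmd 7
emitTrue = op λ _ → idle [ OUT ]≔ (just (just true) , goLeft) [ HOT ]≔ right

-- From the right, the closing zero of a unary number comes first, then a one for each zero before
-- the mark on `HOT`. The head of `OUT` stays on the blank to the left of what has been written.
emitOne : Cmd 7
emitOne = on OUT (just (just false) , goLeft)
        ⨾ while (is false at HOT) emitTrue
        ⨾ rewind HOT ⨾ on IN right

-- `spreadAll` serves here to carry the head of `IN` over the matrix to the number of pebbles, whose
-- ones `emitOne` counts off.
emit : Cmd 7
emit = skip ⨾ spreadAll ⨾ while (is true at IN) emitOne ⨾ on OUT right

program : Cmd 7
program = setup ⨾ search ⨾ emit

-- Correctness of the program

word : List Bool → List Bool → Tape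
word ls rs = tape (map just ls) (map just rs)

replicate-ʳ++ : ∀ m {b : Bool} {xs} → replicate m b ʳ++ xs ≡ replicate m b ++ xs
replicate-ʳ++ zero    = refl
replicate-ʳ++ (suc m) {b} {xs} = trans (replicate-ʳ++ m) (shift-∷ m)
  where
  shift-∷ : ∀ m → replicate m b ++ b ∷ xs ≡ b ∷ replicate m b ++ xs
  shift-∷ zero    = refl
  shift-∷ (suc m) = cong (b ∷_) (shift-∷ m)

unary-ʳ++ : ∀ m {xs} → unary m ʳ++ xs ≡ false ∷ replicate m true ʳ++ xs
unary-ʳ++ zero    = refl
unary-ʳ++ (suc m) = unary-ʳ++ m

performs-on : ∀ {k} (i : Fin k) a ts → performs (idle [ i ]≔ a) ts ≡ ts [ i ]≔ perform a (lookup ts i)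
performs-on zero    a (t ∷ ts) = cong (_ ∷_) (performs-idle ts)
performs-on (suc i) a (t ∷ ts) = cong (t ∷_) (performs-on i a ts)

-- Functions computed by the loops

rows : ∀ {m n} → (Fin m → Fin n → Bool) → List Bool
rows a = concat (tabulate (λ u → tabulate (a u)))

-- The union of `t` with the neighbourhood of `s`, accumulated in the order in which the machine
-- meets the rows.
spread : ∀ {m n} → (Fin m → Bool) → (Fin m → Fin n → Bool) → (Fin n → Bool) → Fin n → Bool
spread {zero}  s a t = t
spread {suc m} s a t = spread (s ∘ suc) (a ∘ suc) (λ w → t w ∨ (a zero w ∧ s zero))

-- The conjunction is accumulated from the first pebble on, as on `OK`.
verdict : ∀ {k n} → (Fin n → Bool) → (Fin k → Fin n) → Bool → Bool
verdict {zero}  t g b = b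
verdict {suc k} t g b = verdict t (g ∘ suc) (b ∧ t (g zero))

hotAt : ∀ {n} → ℕ → Fin n → Bool
hotAt v u = toℕ u ≡ᵇ v

module Balls {n k} (a : Fin n → Fin n → Bool) (σ : Fin k → Fin n) where

  grow : (Fin n → Bool) → Fin n → Bool
  grow t = spread t a t

  ball : ℕ → (Fin n → Bool) → Fin n → Bool
  ball zero    t = t
  ball (suc j) t = ball j (grow t)

  hits : (Fin n → Bool) → Bool
  hits t = verdict t σ true

  -- For the adjacency matrix of a graph and the number `v` of a vertex, this says that all start
  -- vertices are within distance `r` of it.
  good : ℕ → ℕ → Bool
  good r v = hits (ball r (hotAt v))

-- Executions of the loops

module Runs (X : ℕ) where

  module _ {k : ℕ} where

    infix 4 _⊢_⇒_
    _⊢_⇒_ : Cmd k → Vec Tape k → Vec Tape k → Set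
    _⊢_⇒_ = Run X

    run-on : ∀ (i : Fin k) {a ts t} → lookup ts i ≡ t → on i a ⊢ ts ⇒ (ts [ i ]≔ perform a t)
    run-on i {a} {ts} refl = subst (on i a ⊢ ts ⇒_) (performs-on i a ts) op

    -- Successive updates of one tape collapse into the last, which keeps final states in the form
    -- `ts [ i ]≔ u`.
    run-overwrite : ∀ (i : Fin k) {c us t u} (ts : Vec Tape k) →
                    c ⊢ us ⇒ ((ts [ i ]≔ t) [ i ]≔ u) → c ⊢ us ⇒ (ts [ i ]≔ u)
    run-overwrite i {c} {us} ts = subst (c ⊢ us ⇒_) ([]≔-idempotent ts i)

    loop-overwrite : ∀ (i : Fin k) {b c m us t u} (ts : Vec Tape k) → Loop X b c m us ((ts [ i ]≔ t) [ i ]≔ u) →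
                     Loop X b c m us (ts [ i ]≔ u)
    loop-overwrite i {b} {c} {m} {us} ts = subst (Loop X b c m us) ([]≔-idempotent ts i)

    loop-unchanged : ∀ (i : Fin k) {b c m us} {ts : Vec Tape k} {t} → lookup ts i ≡ t →
                     Loop X b c m us ts → Loop X b c m us (ts [ i ]≔ t)
    loop-unchanged i {b} {c} {m} {us} {ts} refl = subst (Loop X b c m us) (sym ([]≔-lookup ts i))

    at-scan : ∀ {A : Set} (f : Symbol → A) (i : Fin k) ts {t x} → lookup ts i ≡ t → f (scan t) ≡ x →
              (f at i) (scans ts) ≡ x
    at-scan f i ts refl fx = trans (cong f (lookup-map i scan ts)) fx

    rewind-loop : ∀ (i : Fin k) ls {ts r rs} → lookup ts i ≡ word ls (r ∷ rs) →
                  Loop X (bit? at i) (on i left) (suc (length ls)) ts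
                       (ts [ i ]≔ tape [] (nothing ∷ map just (ls ʳ++ r ∷ rs)))
    rewind-loop i [] {ts} e = again (at-scan bit? i ts e refl) (run-on i e)
      (done (at-scan bit? i (ts [ i ]≔ _) (lookup∘update i ts _) refl))
    rewind-loop i (l ∷ ls) {ts} e = again (at-scan bit? i ts e refl) (run-on i e)
      (loop-overwrite i ts (rewind-loop i ls (lookup∘update i ts _)))

    -- With `ls` empty, the step before the loop already reaches the blank. Otherwise that step
    -- consumes `l`, and the loop makes `length (l ∷ ls)` rounds.
    rewind-from : ∀ (i : Fin k) ls {ts rs ws} → lookup ts i ≡ word ls rs → ls ʳ++ rs ≡ ws → length ls ≤ X →
                  rewind i ⊢ ts ⇒ (ts [ i ]≔ word [] ws)
    rewind-from i [] {ts} e refl p = run-overwrite i ts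
      (run-on i e ⨾ while z≤n (done (at-scan bit? i (ts [ i ]≔ _) (lookup∘update i ts _) refl))
                  ⨾ run-on i (lookup∘update i ts _))
    rewind-from i (l ∷ ls) {ts} e refl p = run-overwrite i ts
      (run-on i e ⨾ while p (loop-overwrite i ts (rewind-loop i ls (lookup∘update i ts _)))
                  ⨾ run-on i (lookup∘update i ts _))

    rewinds : ∀ (i : Fin k) {ts} ls {rs ws} → lookup ts i ≡ word ls rs → ls ʳ++ rs ≡ ws → length ws ≤ X →
              rewind i ⊢ ts ⇒ (ts [ i ]≔ word [] ws)
    rewinds i ls {rs} {ws} e refl p =
      rewind-from i ls e refl (≤-trans (≤-trans (m≤m+n _ _) (≤-reflexive (sym (length-ʳ++ ls)))) p)

    seek-loop : ∀ b (i : Fin k) m {ts ls rs} → lookup ts i ≡ word ls (replicate m b ++ rs) →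
                is b (hd (map just rs)) ≡ false →
                Loop X (is b at i) (on i right) m ts (ts [ i ]≔ word (replicate m b ʳ++ ls) rs)
    seek-loop b i zero    {ts} e stop = loop-unchanged i e (done (at-scan (is b) i ts e stop))
    seek-loop b i (suc m) {ts} e stop = again (at-scan (is b) i ts e (is-refl b)) (run-on i e)
      (loop-overwrite i ts (seek-loop b i m (lookup∘update i ts _) stop))
      where
      is-refl : ∀ b → is b (just b) ≡ true
      is-refl true  = refl
      is-refl false = refl

  seek-run : ∀ {k} b (i : Fin k) m {ts ls rs} → lookup ts i ≡ word ls (replicate m b ++ rs) →
             is b (hd (map just rs)) ≡ false → m ≤ X →
             seek b i ⊢ ts ⇒ (ts [ i ]≔ word (replicate m b ʳ++ ls) rs)
  seek-run b i m e stop p = while p (seek-loop b i m e stop)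

  skip-run : ∀ m {ls z o h s t r f} → m ≤ X →
             skip ⊢ word ls (unary m ++ z) ∷ o ∷ h ∷ s ∷ t ∷ r ∷ f ∷ []
                  ⇒ word (unary m ʳ++ ls) z ∷ o ∷ h ∷ s ∷ t ∷ r ∷ f ∷ []
  skip-run m {ls} {z} p rewrite unary-ʳ++ m {ls} | ++-assoc (replicate m true) [ false ] z =
    seek-run true IN m refl refl p ⨾ run-on IN refl

  -- The target holds a word of the same length, so nothing of it remains after overwriting. All
  -- tapes are spelled out so that each step holds by computation.
  copy-hot-new : ∀ {m} (x y : Fin m → Bool) {i o ls s ls′ r f} →
    Loop X (bit? at HOT) (copyBit HOT NEW) m
         (i ∷ o ∷ word ls (tabulate x) ∷ s ∷ word ls′ (tabulate y) ∷ r ∷ f ∷ [])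
         (i ∷ o ∷ word (tabulate x ʳ++ ls) [] ∷ s ∷ word (tabulate x ʳ++ ls′) [] ∷ r ∷ f ∷ [])
  copy-hot-new {zero}  x y = done refl
  copy-hot-new {suc m} x y = again refl op (copy-hot-new (x ∘ suc) (y ∘ suc))

  copy-new-old : ∀ {m} (x y : Fin m → Bool) {i o h ls ls′ r f} →
    Loop X (bit? at NEW) (copyBit NEW OLD) m
         (i ∷ o ∷ h ∷ word ls′ (tabulate y) ∷ word ls (tabulate x) ∷ r ∷ f ∷ [])
         (i ∷ o ∷ h ∷ word (tabulate x ʳ++ ls′) [] ∷ word (tabulate x ʳ++ ls) [] ∷ r ∷ f ∷ [])
  copy-new-old {zero}  x y = done refl
  copy-new-old {suc m} x y = again refl op (copy-new-old (x ∘ suc) (y ∘ suc))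

  spread-row-loop : ∀ {m} (a t : Fin m → Bool) {b l z o h ls ss ls′ r f} →
    Loop X (bit? at NEW) spreadBit m
      (word l (tabulate a ++ z) ∷ o ∷ h ∷ word ls (b ∷ ss) ∷ word ls′ (tabulate t) ∷ r ∷ f ∷ [])
      (word (tabulate a ʳ++ l) z ∷ o ∷ h ∷ word ls (b ∷ ss) ∷
       word (tabulate (λ w → t w ∨ (a w ∧ b)) ʳ++ ls′) [] ∷ r ∷ f ∷ [])
  spread-row-loop {zero}  a t = done refl
  spread-row-loop {suc m} a t = again refl op (spread-row-loop (a ∘ suc) (t ∘ suc))

  ʳ++-[] : ∀ (xs : List Bool) → (xs ʳ++ []) ʳ++ [] ≡ xs
  ʳ++-[] xs = trans (ʳ++-ʳ++ xs) (++-identityʳ xs)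

  module _ {n} (n≤X : n ≤ X) where

    tabulate-bound : ∀ (t : Fin n → Bool) → length (tabulate t) ≤ X
    tabulate-bound t = ≤-trans (≤-reflexive (length-tabulate t)) n≤X

    -- For the induction, the `m` rows still to come are kept apart from the `n` columns; the bits
    -- of `s` still to be read belong to these rows.
    spread-loop : ∀ {m} (s : Fin m → Bool) (a : Fin m → Fin n → Bool) t {l z o h ls r f} →
      Loop X (bit? at OLD) (spreadRow ⨾ rewind NEW ⨾ on OLD right) m
        (word l (rows a ++ z) ∷ o ∷ h ∷ word ls (tabulate s) ∷ word [] (tabulate t) ∷ r ∷ f ∷ [])
        (word (rows a ʳ++ l) z ∷ o ∷ h ∷ word (tabulate s ʳ++ ls) [] ∷ word [] (tabulate (spread s a t)) ∷ r ∷ f ∷ [])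
    spread-loop {zero}  s a t = done refl
    spread-loop {suc m} s a t {l} {z}
      rewrite ++-assoc (tabulate (a zero)) (rows (a ∘ suc)) z
            | ++-ʳ++ (tabulate (a zero)) {rows (a ∘ suc)} {l} =
      again refl
        (while n≤X (spread-row-loop (a zero) t)
         ⨾ rewinds NEW (tabulate t′ ʳ++ []) refl (ʳ++-[] (tabulate t′)) (tabulate-bound t′)
         ⨾ run-on OLD refl)
        (spread-loop (s ∘ suc) (a ∘ suc) t′)
      where t′ = λ w → t w ∨ (a zero w ∧ s zero)

    -- How the word on `NEW` is split depends on `i`, so only its recombination is stated: the word
    -- is intact, and rewinding restores the tape.
    walk-loop : ∀ {m} (i : Fin m) (t : Fin m → Bool) {l z o h s l′ r f} → ∃₂ λ l″ rs →
      Loop X (is true at IN) advance (toℕ i)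
        (word l (unary (toℕ i) ++ z) ∷ o ∷ h ∷ s ∷ word l′ (tabulate t) ∷ r ∷ f ∷ [])
        (word (replicate (toℕ i) true ʳ++ l) (false ∷ z) ∷ o ∷ h ∷ s ∷ word l″ (t i ∷ rs) ∷ r ∷ f ∷ []) ×
      l″ ʳ++ t i ∷ rs ≡ l′ ʳ++ tabulate t
    walk-loop {suc m} zero    t = _ , _ , done refl , refl
    walk-loop {suc m} (suc i) t with walk-loop i (t ∘ suc)
    ... | l″ , rs , loop , e = l″ , rs , again refl op loop , e

    check-one : ∀ (i : Fin n) (t : Fin n → Bool) {l z o h s r b} →
      checkOne ⊢ word l (unary (toℕ i) ++ z) ∷ o ∷ h ∷ s ∷ word [] (tabulate t) ∷ r ∷ word [] [ b ] ∷ []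
               ⇒ word (unary (toℕ i) ʳ++ l) z ∷ o ∷ h ∷ s ∷ word [] (tabulate t) ∷ r ∷ word [] [ b ∧ t i ] ∷ []
    check-one i t {l} rewrite unary-ʳ++ (toℕ i) {l} with walk-loop i t
    ... | l″ , rs , loop , e =
      while (≤-trans (<⇒≤ (toℕ<n i)) n≤X) loop ⨾ op ⨾ rewinds NEW l″ refl e (tabulate-bound t)

    check-loop : ∀ {k} (g : Fin k → Fin n) t b {l o h s r} →
      Loop X (bit? at IN) checkOne k
        (word l (encodePebbles g) ∷ o ∷ h ∷ s ∷ word [] (tabulate t) ∷ r ∷ word [] [ b ] ∷ [])
        (word (encodePebbles g ʳ++ l) [] ∷ o ∷ h ∷ s ∷ word [] (tabulate t) ∷ r ∷ word [] [ verdict t g b ] ∷ [])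
    check-loop {zero}  g t b = done refl
    check-loop {suc k} g t b {l}
      rewrite ++-ʳ++ (unary (toℕ (g zero))) {encodePebbles (g ∘ suc)} {l} =
      -- The code of a pebble contains at least its closing zero, so the loop goes on until all
      -- pebbles are read.
      again (nonblank (toℕ (g zero))) (check-one (g zero) t) (check-loop (g ∘ suc) t _)
      where
      nonblank : ∀ j {z} → bit? (hd (map just (unary j ++ z))) ≡ true
      nonblank zero    = refl
      nonblank (suc j) = refl

  replicate-ʳ++-[] : ∀ m {b : Bool} → replicate m b ʳ++ [] ≡ replicate m b
  replicate-ʳ++-[] m = trans (replicate-ʳ++ m) (++-identityʳ _)

  seek-start : ∀ {k} b (i : Fin k) m {ts rs} → lookup ts i ≡ word [] (replicate m b ++ rs) →
               is b (hd (map just rs)) ≡ false → m ≤ X →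
               seek b i ⊢ ts ⇒ (ts [ i ]≔ word (replicate m b) rs)
  seek-start b i m {ts} {rs} e stop p =
    subst (λ ls → seek b i ⊢ ts ⇒ (ts [ i ]≔ word ls rs)) (replicate-ʳ++-[] m) (seek-run b i m e stop p)

  m≤length-unary : ∀ m {z} → m ≤ length (unary m ++ z)
  m≤length-unary zero    = z≤n
  m≤length-unary (suc m) = s≤s (m≤length-unary m)

  tabulate-false : ∀ n → replicate n false ≡ tabulate {n = n} (λ _ → false)
  tabulate-false zero    = refl
  tabulate-false (suc n) = cong (false ∷_) (tabulate-false n)

  tabulate-hotAt : ∀ {n} v m → v + suc m ≡ n → replicate v false ++ true ∷ replicate m false ≡ tabulate {n = n} (hotAt v)
  tabulate-hotAt zero    m refl = cong (true ∷_) (tabulate-false m)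
  tabulate-hotAt (suc v) m refl = cong (false ∷_) (tabulate-hotAt v m refl)

  -- The program on an encoded instance

  module Input {n k} (a : Fin n → Fin n → Bool) (σ : Fin k → Fin n) where

    open Balls a σ

    input : Word
    input = unary n ++ rows a ++ unary k ++ encodePebbles σ

    module _ (input≤X : length input ≤ X) where

      n≤X : n ≤ X
      n≤X = ≤-trans (m≤length-unary n) input≤X

      k≤X : k ≤ X
      k≤X = ≤-trans (m≤length-unary k) (≤-trans (length-++-≤ʳ _ {rows a})
                    (≤-trans (length-++-≤ʳ _ {unary n}) input≤X))

      -- At the end of a pass the input, read in four parts, lies reversed to the left of the head
      -- of `IN`.
      read-all : encodePebbles σ ʳ++ unary k ʳ++ rows a ʳ++ unary n ʳ++ [] ≡ input ʳ++ []
      read-all = sym (trans (++-ʳ++ (unary n)) (trans (++-ʳ++ (rows a)) (++-ʳ++ (unary k))))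

      pass-run : ∀ s t {o h r b} →
        pass ⊢ word [] input ∷ o ∷ h ∷ word [] (tabulate s) ∷ word [] (tabulate t) ∷ r ∷ word [] [ b ] ∷ []
             ⇒ word [] input ∷ o ∷ h ∷ word [] (tabulate t) ∷ word [] (tabulate (grow t)) ∷ r ∷
               word [] [ hits (grow t) ] ∷ []
      pass-run s t =
        while n≤X (copy-new-old t s)
        ⨾ rewinds OLD (tabulate t ʳ++ []) refl (ʳ++-[] (tabulate t)) (tabulate-bound n≤X t)
        ⨾ rewinds NEW (tabulate t ʳ++ []) refl (ʳ++-[] (tabulate t)) (tabulate-bound n≤X t)
        ⨾ skip-run n n≤X
        ⨾ while n≤X (spread-loop n≤X t a t)
        ⨾ rewinds OLD (tabulate t ʳ++ []) refl (ʳ++-[] (tabulate t)) (tabulate-bound n≤X t)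
        ⨾ skip-run k k≤X
        ⨾ run-on OK refl
        ⨾ while k≤X (check-loop n≤X σ (grow t) true)
        ⨾ rewinds IN (encodePebbles σ ʳ++ unary k ʳ++ rows a ʳ++ unary n ʳ++ []) refl
            (trans (cong (_ʳ++ []) read-all) (ʳ++-[] input)) input≤X

      lastVerdict : ℕ → (Fin n → Bool) → Bool → Bool
      lastVerdict zero    t b = b
      lastVerdict (suc j) t b = lastVerdict j (grow t) (hits (grow t))

      -- Every pass sets `OK` afresh, so one pass suffices to forget `b`. At radius 0 the stale `b`
      -- would be left; the search starts at radius 1, which loses nothing against the bound c* + 1.
      lastVerdict-ball : ∀ j t b → lastVerdict (suc j) t b ≡ hits (ball (suc j) t)
      lastVerdict-ball zero    t b = refl
      lastVerdict-ball (suc j) t b = lastVerdict-ball j (grow t) (hits (grow t))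

      passes-loop : ∀ j s t b {l o h} → ∃ λ s′ →
        Loop X (bit? at RAD) (pass ⨾ on RAD right) j
          (word [] input ∷ o ∷ h ∷ word [] (tabulate s) ∷ word [] (tabulate t) ∷
           word l (replicate j true) ∷ word [] [ b ] ∷ [])
          (word [] input ∷ o ∷ h ∷ word [] (tabulate {n = n} s′) ∷ word [] (tabulate (ball j t)) ∷
           word (replicate j true ʳ++ l) [] ∷ word [] [ lastVerdict j t b ] ∷ [])
      passes-loop zero    s t b = s , done refl
      passes-loop (suc j) s t b with passes-loop j t (grow t) (hits (grow t))
      ... | s′ , loop = s′ , again refl (pass-run s t ⨾ run-on RAD refl) loop

      try-run : ∀ v m r s t {o} → v + suc m ≡ n → suc r ≤ X → ∃₂ λ s′ t′ →
        try ⊢ word [] input ∷ o ∷ word (replicate v false) (replicate (suc m) false) ∷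
              word [] (tabulate s) ∷ word [] (tabulate t) ∷ word [] (replicate (suc r) true) ∷ word [] [ false ] ∷ []
            ⇒ word [] input ∷ o ∷
              shift (if good (suc r) v then stay else goRight)
                    (word (replicate v false) (good (suc r) v ∷ replicate m false)) ∷
              word [] (tabulate {n = n} s′) ∷ word [] (tabulate {n = n} t′) ∷
              word [] (replicate (suc r) true) ∷ word [] [ good (suc r) v ] ∷ []
      -- Puts the goal in terms of the verdict that `passes-loop` leaves on `OK`.
      try-run v m r s t v+m≡n r≤X rewrite sym (lastVerdict-ball r (hotAt v) false)
        with passes-loop (suc r) s (hotAt v) false
      ... | s′ , loop = s′ , ball (suc r) (hotAt v) ,
        (run-on HOT refl
        ⨾ rewinds HOT (replicate v false) refl (trans (replicate-ʳ++ v) hot) (tabulate-bound n≤X x)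
        ⨾ while n≤X (copy-hot-new x t)
        ⨾ rewinds HOT (tabulate x ʳ++ []) refl (trans (ʳ++-[] (tabulate x)) (sym hot)) hot≤X
        ⨾ rewinds NEW (tabulate x ʳ++ []) refl (ʳ++-[] (tabulate x)) (tabulate-bound n≤X x)
        ⨾ while r≤X loop
        ⨾ rewinds RAD (replicate (suc r) true ʳ++ []) refl (ʳ++-[] (replicate (suc r) true))
            (≤-trans (≤-reflexive (length-replicate (suc r))) r≤X)
        -- The mark is the first one on `HOT`, so this finds `v` again. The last step writes the
        -- verdict over it, clearing the mark on failure.
        ⨾ seek-start false HOT v refl refl (≤-trans (m≤m+n v (suc m)) (≤-trans (≤-reflexive v+m≡n) n≤X))
        ⨾ op)
        where
        x = hotAt {n} v
        hot = tabulate-hotAt v m v+m≡n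
        hot≤X : length (replicate v false ++ true ∷ replicate m false) ≤ X
        hot≤X = subst (λ w → length w ≤ X) (sym hot) (tabulate-bound n≤X x)

      -- `v₀` is the first vertex tested, so that the recursion over the remaining vertices can
      -- state its failure.
      data Outcome (r : ℕ) : Tape → Bool → ℕ → Set where
        found  : ∀ {v₀} v m → v + suc m ≡ n → good (suc r) v ≡ true →
                 Outcome r (word (replicate v false) (true ∷ replicate m false)) true v₀
        failed : ∀ {v₀} → (∀ v → v₀ ≤ v → v < n → good (suc r) v ≡ false) →
                 Outcome r (word (replicate n false) []) false v₀

      search-state : Tape → Tape → ℕ → (Fin n → Bool) → (Fin n → Bool) → Bool → Vec Tape 7
      search-state o h r s t b =
        word [] input ∷ o ∷ h ∷ word [] (tabulate s) ∷ word [] (tabulate t) ∷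
        word [] (replicate (suc r) true) ∷ word [] [ b ] ∷ []

      tryAll-loop : ∀ m v r s t {o} → v + m ≡ n → suc r ≤ X →
        ∃₂ λ c h → ∃₂ λ s′ t′ → ∃ λ b → c ≤ m × Outcome r h b v ×
        Loop X (λ ss → (is false at OK) ss ∧ (bit? at HOT) ss) try c
          (search-state o (word (replicate v false) (replicate m false)) r s t false)
          (search-state o h r s′ t′ b)
      tryAll-loop zero v r s t v+0≡n r≤X with trans (sym (+-identityʳ v)) v+0≡n
      ... | refl = _ , _ , s , t , _ , z≤n , failed (λ u v≤u u<v → ⊥-elim (<⇒≱ u<v v≤u)) , done refl
      tryAll-loop (suc m) v r s t v+m≡n r≤X with try-run v m r s t v+m≡n r≤X
      ... | s₁ , t₁ , run with good (suc r) v in eq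
      ... | true = _ , _ , s₁ , t₁ , _ , s≤s z≤n , found v m v+m≡n eq , again refl run (done refl)
      ... | false with tryAll-loop m (suc v) r s₁ t₁ (trans (sym (+-suc v m)) v+m≡n) r≤X
      ... | _ , _ , s′ , t′ , _ , c≤m , outcome , loop =
        _ , _ , s′ , t′ , _ , s≤s c≤m , weaken outcome , again refl run loop
        where
        weaken : ∀ {h b} → Outcome r h b (suc v) → Outcome r h b v
        weaken (found u m e g) = found u m e g
        weaken (failed none) = failed λ u v≤u u<n → case m≤n⇒m<n∨m≡n v≤u of λ
          { (inj₁ v<u) → none u v<u u<n ; (inj₂ refl) → eq }

      -- `radius` is one less than the radius of the ball, as the search starts with radius 1;
      -- `rest` counts the vertices after the center.
      record Best : Set where
        field
          center rest radius : ℕ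
          center<n : center + suc rest ≡ n
          is-good  : good (suc radius) center ≡ true
          minimal  : ∀ j v → v < n → good (suc j) v ≡ true → radius ≤ j

        marked : List Bool
        marked = replicate center false ++ true ∷ replicate rest false

      v<n⇒≤X : ∀ {v m} → v + suc m ≡ n → length (replicate v false ++ true ∷ replicate m false) ≤ X
      v<n⇒≤X {v} {m} e = subst (λ w → length w ≤ X) (sym (tabulate-hotAt v m e)) (tabulate-bound n≤X (hotAt {n} v))

      -- Some center is known to be good at radius `suc (d + r)`, so the search ends within `suc d`
      -- more rounds. The last hypothesis is the invariant that all positive radii below `suc r`
      -- have failed.
      search-loop : ∀ d r s t {o} → suc (d + r) ≤ X →
        (∃ λ v → v < n × good (suc (d + r)) v ≡ true) →
        (∀ j v → v < n → good (suc j) v ≡ true → r ≤ j) →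
        Σ Best λ best → ∃₂ λ c r′ → ∃₂ λ s′ t′ → c ≤ suc d ×
        Loop X (is false at OK) (tryAll ⨾ rewind HOT ⨾ on RAD left ⨾ on RAD (just (just true) , stay)) c
          (search-state o (word [] (replicate n false)) r s t false)
          (search-state o (word [] (Best.marked best)) r′ s′ t′ true)
      search-loop d r s t bound ex min
        with tryAll-loop n 0 r s t refl (≤-trans (s≤s (m≤n+m r d)) bound)
      ... | _ , _ , s₁ , t₁ , _ , c≤n , found v m e g , loop =
        record { center = v ; rest = m ; radius = r ; center<n = e ; is-good = g ; minimal = min } ,
        1 , suc r , s₁ , t₁ , s≤s z≤n ,
        again refl (while (≤-trans c≤n n≤X) loop
                    ⨾ rewinds HOT (replicate v false) refl (replicate-ʳ++ v) (v<n⇒≤X e)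
                    ⨾ run-on RAD refl ⨾ run-on RAD refl)
                   (done refl)
      -- With `d` zero, the current radius is the one known to succeed.
      search-loop zero r s t bound (v , v<n , g) min
          | _ , _ , s₁ , t₁ , _ , c≤n , failed none , loop = case trans (sym g) (none v z≤n v<n) of λ ()
      search-loop (suc d) r s t bound ex min
          | _ , _ , s₁ , t₁ , _ , c≤n , failed none , loop
        with search-loop d (suc r) s₁ t₁ (≤-trans (≤-reflexive (cong suc (+-suc d r))) bound)
               (subst (λ e → ∃ λ v → v < n × good (suc e) v ≡ true) (sym (+-suc d r)) ex)
               -- The failure of this round excludes the current radius, which makes the invariant
               -- strict.
               (λ j v v<n g → case m≤n⇒m<n∨m≡n (min j v v<n g) of λ
                 { (inj₁ r<j) → r<j ; (inj₂ refl) → case trans (sym g) (none v z≤n v<n) of λ () })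
      ... | best , _ , r′ , s′ , t′ , c≤d , loop′ =
        best , _ , r′ , s′ , t′ , s≤s c≤d ,
        again refl (while (≤-trans c≤n n≤X) loop
                    ⨾ rewinds HOT (replicate n false) refl (trans (replicate-ʳ++ n) (++-identityʳ _))
                        (≤-trans (≤-reflexive (length-replicate n)) n≤X)
                    ⨾ run-on RAD refl ⨾ run-on RAD refl)
                   loop′

      -- Writing the solution

      emit-unary : ∀ v {i w z l s t r f} → is false (hd (map just z)) ≡ false →
        Loop X (is false at HOT) emitTrue v
          (i ∷ tape [] (nothing ∷ map just w) ∷ word l (replicate v false ++ z) ∷ s ∷ t ∷ r ∷ f ∷ [])
          (i ∷ tape [] (nothing ∷ map just (replicate v true ʳ++ w)) ∷ word (replicate v false ʳ++ l) z ∷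
           s ∷ t ∷ r ∷ f ∷ [])
      emit-unary zero    stop = done stop
      emit-unary (suc v) stop = again refl op (emit-unary v stop)

      emit-one : ∀ v {w z l ys s t r f} → is false (hd (map just z)) ≡ false →
        length (replicate v false ++ z) ≤ X → v ≤ X →
        emitOne ⊢ word l (true ∷ ys) ∷ tape [] (nothing ∷ map just w) ∷ word [] (replicate v false ++ z) ∷
                  s ∷ t ∷ r ∷ f ∷ []
                ⇒ word (true ∷ l) ys ∷ tape [] (nothing ∷ map just (unary v ++ w)) ∷
                  word [] (replicate v false ++ z) ∷ s ∷ t ∷ r ∷ f ∷ []
      emit-one v {w} stop p v≤X
        -- The ones are prepended singly, which the loop records as `replicate v true` reversed onto
        -- `false ∷ w`.
        rewrite ++-assoc (replicate v true) [ false ] w | sym (replicate-ʳ++ v {true} {false ∷ w}) =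
        run-on OUT refl ⨾ while v≤X (emit-unary v stop)
        ⨾ rewinds HOT (replicate v false ʳ++ []) refl (ʳ++-ʳ++ (replicate v false)) p ⨾ run-on IN refl

      copies : ℕ → ℕ → Word
      copies j v = concat (tabulate {n = j} (λ _ → unary v))

      -- Each copy is put in front of those already written; as all are equal, the one just written
      -- can be counted as the last of those still to come.
      copies-suc : ∀ j v w → copies j v ++ unary v ++ w ≡ copies (suc j) v ++ w
      copies-suc zero    v w = cong (_++ w) (sym (++-identityʳ (unary v)))
      copies-suc (suc j) v w = begin
        (unary v ++ copies j v) ++ unary v ++ w   ≡⟨ ++-assoc (unary v) _ _ ⟩
        unary v ++ copies j v ++ unary v ++ w     ≡⟨ cong (unary v ++_) (copies-suc j v w) ⟩
        unary v ++ copies (suc j) v ++ w          ≡⟨ ++-assoc (unary v) _ _ ⟨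
        copies (suc (suc j)) v ++ w               ∎
        where open ≡-Reasoning

      emit-loop : ∀ j v {w y z l s t r f} → is false (hd (map just z)) ≡ false →
        length (replicate v false ++ z) ≤ X → v ≤ X →
        Loop X (is true at IN) emitOne j
          (word l (unary j ++ y) ∷ tape [] (nothing ∷ map just w) ∷ word [] (replicate v false ++ z) ∷
           s ∷ t ∷ r ∷ f ∷ [])
          (word (replicate j true ʳ++ l) (false ∷ y) ∷ tape [] (nothing ∷ map just (copies j v ++ w)) ∷
           word [] (replicate v false ++ z) ∷ s ∷ t ∷ r ∷ f ∷ [])
      emit-loop zero    v stop p v≤X = done refl
      emit-loop (suc j) v {w} stop p v≤X rewrite sym (copies-suc j v w) =
        again refl (emit-one v stop p v≤X) (emit-loop j v stop p v≤X)

      -- `z` starts with the mark, or is empty in a graph without vertices; either way the counting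
      -- of zeros stops there.
      emit-run : ∀ v s t {z r f} → is false (hd (map just z)) ≡ false →
        length (replicate v false ++ z) ≤ X → v ≤ X → ∃₂ λ i us →
        emit ⊢ word [] input ∷ tape [] [ nothing ] ∷ word [] (replicate v false ++ z) ∷
               word [] (tabulate {n = n} s) ∷ word [] (tabulate t) ∷ r ∷ f ∷ []
             ⇒ i ∷ tape [] (map just (copies k v)) ∷ us
      emit-run v s t stop p v≤X rewrite sym (++-identityʳ (copies k v)) =
        _ , _ , (skip-run n n≤X ⨾ while n≤X (spread-loop n≤X s a t) ⨾ while k≤X (emit-loop k v {w = []} stop p v≤X)
                 ⨾ run-on OUT refl)

      setup-loop : ∀ m {z l o lh ls lt r f} →
        Loop X (is true at IN) appendZero m
          (word l (unary m ++ z) ∷ o ∷ word lh [] ∷ word ls [] ∷ word lt [] ∷ r ∷ f ∷ [])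
          (word (replicate m true ʳ++ l) (false ∷ z) ∷ o ∷ word (replicate m false ʳ++ lh) [] ∷
           word (replicate m false ʳ++ ls) [] ∷ word (replicate m false ʳ++ lt) [] ∷ r ∷ f ∷ [])
      setup-loop zero    = done refl
      setup-loop (suc m) = again refl op (setup-loop m)

      zeros : Fin n → Bool
      zeros _ = false

      -- `b` is fixed by the caller, who knows whether there are vertices.
      setup-run : ∀ {b} → not (bit? (hd (map just (replicate n false)))) ≡ b →
        setup ⊢ word [] input ∷ Vec.replicate 6 (word [] [])
              ⇒ search-state (tape [] [ nothing ]) (word [] (replicate n false)) 0 zeros zeros b
      setup-run refl =
        while n≤X (setup-loop n)
        ⨾ rewinds HOT (replicate n false ʳ++ []) refl (ʳ++-[] (replicate n false)) zeros≤X
        ⨾ rewinds OLD (replicate n false ʳ++ []) refl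
            (trans (ʳ++-[] (replicate n false)) (tabulate-false n)) (tabulate-bound n≤X zeros)
        ⨾ rewinds NEW (replicate n false ʳ++ []) refl
            (trans (ʳ++-[] (replicate n false)) (tabulate-false n)) (tabulate-bound n≤X zeros)
        ⨾ rewinds IN (replicate n true ʳ++ []) refl
            (trans (ʳ++-ʳ++ (replicate n true)) (sym (++-assoc (replicate n true) [ false ] _))) input≤X
        ⨾ op
        where
        zeros≤X : length (replicate n false) ≤ X
        zeros≤X = ≤-trans (≤-reflexive (length-replicate n)) n≤X

      program-run : ∀ d → 0 < n → suc d ≤ X → (∃ λ v → v < n × good (suc d) v ≡ true) →
        Σ Best λ best → ∃₂ λ i us →
        program ⊢ word [] input ∷ Vec.replicate 6 (word [] [])
                ⇒ i ∷ word [] (copies k (Best.center best)) ∷ us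
      program-run d 0<n d<X ex
        with search-loop d 0 zeros zeros
               (≤-trans (≤-reflexive (cong suc (+-identityʳ d))) d<X)
               (subst (λ e → ∃ λ v → v < n × good (suc e) v ≡ true) (sym (+-identityʳ d)) ex)
               (λ _ _ _ _ → z≤n)
      ... | best , _ , _ , s , t , c≤d , loop
        with emit-run (Best.center best) s t {true ∷ replicate (Best.rest best) false} refl (v<n⇒≤X (Best.center<n best))
               (≤-trans (m≤m+n _ _) (≤-trans (≤-reflexive (Best.center<n best)) n≤X))
      ... | i , us , run =
        best , i , us , (setup-run (nonempty 0<n) ⨾ while (≤-trans c≤d d<X) loop ⨾ run)
        where
        nonempty : ∀ {n} → 0 < n → not (bit? (hd (map just (replicate n false)))) ≡ false
        nonempty (s≤s _) = refl

      program-run-empty : n ≡ 0 → ∃₂ λ i us →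
        program ⊢ word [] input ∷ Vec.replicate 6 (word [] []) ⇒ i ∷ word [] (copies k 0) ∷ us
      program-run-empty n≡0 with emit-run 0 zeros zeros {replicate n false} (stop n≡0)
                                   (≤-trans (≤-reflexive (length-replicate n)) n≤X) z≤n
        where
        stop : ∀ {n} → n ≡ 0 → is false (hd (map just (replicate n false))) ≡ false
        stop refl = refl
      ... | i , us , run = i , us , (setup-run (empty n≡0) ⨾ while z≤n (done refl) ⨾ run)
        where
        empty : ∀ {n} → n ≡ 0 → not (bit? (hd (map just (replicate n false)))) ≡ true
        empty refl = refl

-- Balls in the graph

spread-sound : ∀ {m n} (s : Fin m → Bool) (a : Fin m → Fin n → Bool) t {w} → T (spread s a t w) →
               T (t w) ⊎ ∃ λ u → T (a u w) × T (s u)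
spread-sound {zero}  s a t h = inj₁ h
spread-sound {suc m} s a t h with spread-sound (s ∘ suc) (a ∘ suc) _ h
... | inj₂ (u , e) = inj₂ (suc u , e)
... | inj₁ h′ with Equivalence.to T-∨ h′
...   | inj₁ tw = inj₁ tw
...   | inj₂ e  = inj₂ (zero , Equivalence.to T-∧ e)

spread-complete : ∀ {m n} (s : Fin m → Bool) (a : Fin m → Fin n → Bool) t {w} →
                  T (t w) ⊎ (∃ λ u → T (a u w) × T (s u)) → T (spread s a t w)
spread-complete {zero}  s a t (inj₁ tw) = tw
spread-complete {suc m} s a t (inj₁ tw) =
  spread-complete (s ∘ suc) (a ∘ suc) _ (inj₁ (Equivalence.from T-∨ (inj₁ tw)))
spread-complete {suc m} s a t (inj₂ (zero , e)) =
  spread-complete (s ∘ suc) (a ∘ suc) _ (inj₁ (Equivalence.from T-∨ (inj₂ (Equivalence.from T-∧ e))))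
spread-complete {suc m} s a t (inj₂ (suc u , e)) = spread-complete (s ∘ suc) (a ∘ suc) _ (inj₂ (u , e))

verdict-sound : ∀ {k n} (t : Fin n → Bool) (g : Fin k → Fin n) b → T (verdict t g b) → T b × (∀ p → T (t (g p)))
verdict-sound {zero}  t g b h = h , λ ()
verdict-sound {suc k} t g b h with verdict-sound t (g ∘ suc) _ h
... | h′ , rest with Equivalence.to T-∧ h′
...   | tb , t₀ = tb , λ { zero → t₀ ; (suc p) → rest p }

verdict-complete : ∀ {k n} (t : Fin n → Bool) (g : Fin k → Fin n) b → T b → (∀ p → T (t (g p))) → T (verdict t g b)
verdict-complete {zero}  t g b tb all = tb
verdict-complete {suc k} t g b tb all =
  verdict-complete t (g ∘ suc) _ (Equivalence.from T-∧ (tb , all zero)) (all ∘ suc)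

module _ {n} (G : Graph n) where
  open Graph G

  _++ʷ_ : ∀ {u v w i j} → Walk u v i → Walk v w j → Walk u w (i + j)
  []      ++ʷ q = q
  (e ∷ p) ++ʷ q = e ∷ (p ++ʷ q)

  snoc : ∀ {u v w i} → Walk u v i → Adj v w → Walk u w (suc i)
  snoc []      e = e ∷ []
  snoc (d ∷ p) e = d ∷ snoc p e

  unsnoc : ∀ {u w i} → Walk u w (suc i) → ∃ λ v → Walk u v i × Adj v w
  unsnoc (e ∷ [])    = _ , [] , e
  unsnoc (d ∷ e ∷ p) with unsnoc (e ∷ p)
  ... | v , q , e′ = v , d ∷ q , e′

  vertex : ∀ {u v i} → Walk u v i → Fin (suc i) → Fin n
  vertex {u} p       zero    = u
  vertex     (e ∷ p) (suc j) = vertex p j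

  prefix : ∀ {u v i} (p : Walk u v i) j → Walk u (vertex p j) (toℕ j)
  prefix p       zero    = []
  prefix (e ∷ p) (suc j) = e ∷ prefix p j

  suffix : ∀ {u v i} (p : Walk u v i) j → Walk (vertex p j) v (i ∸ toℕ j)
  suffix p       zero    = p
  suffix (e ∷ p) (suc j) = suffix p j

  -- A walk visiting a vertex twice can be cut short.
  least-walk<n : ∀ {u v i} → Least (Walk u v) i → i < n
  least-walk<n {u} {v} {i} (p , min) with i <? n
  ... | yes i<n = i<n
  ... | no i≮n with pigeonhole (s≤s (≮⇒≥ i≮n)) (vertex p)
  ...   | j , l , j<l , e = ⊥-elim (<⇒≱ shorter (min _ (prefix p j ++ʷ subst (λ x → Walk x v _) (sym e) (suffix p l))))
    where
    open ≤-Reasoning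
    shorter : toℕ j + (i ∸ toℕ l) < i
    shorter = begin-strict
      toℕ j + (i ∸ toℕ l)   <⟨ +-monoˡ-< (i ∸ toℕ l) j<l ⟩
      toℕ l + (i ∸ toℕ l)   ≡⟨ m+[n∸m]≡n (≤-pred (toℕ<n l)) ⟩
      i                     ∎

  module _ {k} (σ : Fin k → Fin n) where
    open Balls adjacent? σ

    -- `ball` grows `t` itself first, so that growth accounts for the last edge of a walk from `w`
    -- to `t`. Hence `snoc` here and `unsnoc` in the converse.
    ball-sound : ∀ j t {w} → T (ball j t w) → ∃₂ λ u i → T (t u) × Walk w u i × i ≤ j
    ball-sound zero    t {w} h = w , 0 , h , [] , z≤n
    ball-sound (suc j) t h with ball-sound j (grow t) h
    ... | u , i , g , p , i≤j with spread-sound t adjacent? t g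
    ...   | inj₁ tu = u , i , tu , p , m≤n⇒m≤1+n i≤j
    ...   | inj₂ (v , e , tv) = v , suc i , tv , snoc p (symmetric e) , s≤s i≤j

    ball-complete : ∀ j t {w u i} → T (t u) → Walk w u i → i ≤ j → T (ball j t w)
    ball-complete zero    t tu []    z≤n = tu
    -- A walk shorter than the radius waits at its end, since `grow t` contains `t`.
    ball-complete (suc j) t tu []    z≤n = ball-complete j (grow t) (spread-complete t adjacent? t (inj₁ tu)) [] z≤n
    ball-complete (suc j) t {u = u} tu p@(_ ∷ _) (s≤s i≤j) with unsnoc p
    ... | v , q , e = ball-complete j (grow t) (spread-complete t adjacent? t (inj₂ (u , symmetric e , tu))) q i≤j

    good-sound : ∀ r c → good r (toℕ c) ≡ true → ∀ p → ∃ λ i → Walk (σ p) c i × i ≤ r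
    good-sound r c g p
      with ball-sound r (hotAt (toℕ c)) (proj₂ (verdict-sound (ball r (hotAt (toℕ c))) σ true (Equivalence.from T-≡ g)) p)
    ... | u , i , h , q , i≤r with toℕ-injective (≡ᵇ⇒≡ (toℕ u) (toℕ c) h)
    ...   | refl = i , q , i≤r

    good-complete : ∀ r c → (∀ p → ∃ λ i → Walk (σ p) c i × i ≤ r) → good r (toℕ c) ≡ true
    good-complete r c near = Equivalence.to T-≡ (verdict-complete (ball r (hotAt (toℕ c))) σ true tt λ p →
      let _ , q , i≤r = near p in ball-complete r (hotAt (toℕ c)) (≡⇒≡ᵇ (toℕ c) (toℕ c) refl) q i≤r)

-- The approximation guarantee

foldr-⊔-least : ∀ {k} (f : Fin k → ℕ) {m} → (∀ p → f p ≤ m) → VecF.foldr _⊔_ 0 f ≤ m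
foldr-⊔-least {zero}  f b = z≤n
foldr-⊔-least {suc k} f b = ⊔-lub (b zero) (foldr-⊔-least (f ∘ suc) (b ∘ suc))

foldr-⊔-upper : ∀ {k} (f : Fin k → ℕ) p → f p ≤ VecF.foldr _⊔_ 0 f
foldr-⊔-upper f zero    = m≤m⊔n _ _
foldr-⊔-upper f (suc p) = ≤-trans (foldr-⊔-upper (f ∘ suc) p) (m≤n⊔m (f zero) _)

-- The common value is a number rather than a vertex, which covers the graph without vertices as
-- well.
encode-constant : ∀ {k n v} (f : Fin k → Fin n) → (∀ p → toℕ (f p) ≡ v) →
                  concat (tabulate {n = k} (λ _ → unary v)) ≡ encodePebbles f
encode-constant f e = cong concat (tabulate-cong (λ p → cong unary (sym (e p))))

module Approximation (I : Instance) where
  open Instance I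
  open Balls adjacent? σ

  dist-walk : ∀ u v → Walk u v (dist u v)
  dist-walk u v = proj₁ (proj₂ (shortest u v))

  dist-min : ∀ {u v i} → Walk u v i → dist u v ≤ i
  dist-min {u} {v} {i} p = proj₂ (proj₂ (shortest u v)) i p

  -- Distances are less than `n`; this supplies the radius at which the search is sure to stop.
  good-n : ∀ c → good n (toℕ c) ≡ true
  good-n c = good-complete graph σ n c λ p →
    _ , dist-walk (σ p) c , <⇒≤ (least-walk<n graph (proj₂ (shortest (σ p) c)))

  -- Each pebble ends at `μ p₀` or, by the clique property, at a neighbour of it, from where one
  -- more edge leads there.
  good-solution : ∀ (S : Solution I) p → good (suc (Max I S)) (toℕ (Solution.μ S p)) ≡ true
  good-solution S p₀ = good-complete graph σ _ (μ p₀) near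
    where
    open Solution S
    near : ∀ p → ∃ λ i → Walk (σ p) (μ p₀) i × i ≤ suc (Max I S)
    near p with μ p ≟ μ p₀
    ... | yes e = _ , subst (λ v → Walk (σ p) v (dist (σ p) (μ p))) e (dist-walk (σ p) (μ p)) , m≤n⇒m≤1+n (foldr-⊔-upper _ p)
    ... | no ¬e = _ , snoc graph (dist-walk (σ p) (μ p)) (clique (p , refl) (p₀ , refl) ¬e) , s≤s (foldr-⊔-upper _ p)

  gather : Fin n → Solution I
  gather c = record { μ = λ _ → c ; clique = λ { (_ , refl) (_ , refl) ≢ → ⊥-elim (≢ refl) } }

  -- The pebble `p` whose distance is bounded also provides a rival center: its end vertex in `S` is
  -- good at radius `suc (Max I S)`, so minimality gives `r ≤ Max I S`.
  gather-bound : ∀ {r} c (S : Solution I) → good (suc r) (toℕ c) ≡ true →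
                 (∀ j v → v < n → good (suc j) v ≡ true → r ≤ j) → Max I (gather c) ≤ Max I S + 1
  gather-bound {r} c S g min = foldr-⊔-least _ λ p →
    let _ , q , i≤r = good-sound graph σ (suc r) c g p in
    ≤-trans (dist-min q) (≤-trans i≤r (≤-trans
      (s≤s (min (Max I S) _ (toℕ<n (Solution.μ S p)) (good-solution S p))) (≤-reflexive (+-comm 1 (Max I S)))))

  stay-put : n ≡ 0 → Solution I
  stay-put n≡0 = record { μ = σ ; clique = λ {u} → ⊥-elim (¬Fin0 (subst Fin n≡0 u)) }

  Outputs : Word → Set
  Outputs w = ∃₂ λ i ls → ∃ λ us →
    Run (length (encodeInstance I)) program (Machine.initialᵃ program (encodeInstance I))
        (i ∷ tape ls (map just w) ∷ us)

  approximate : ∃ λ S → (∀ (S* : Solution I) → IsOptimal I S* → Max I S ≤ Max I S* + 1) ×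
                   Outputs (encodeSolution I S)
  approximate with n ≟ⁿ 0
  ... | yes n≡0 with Runs.Input.program-run-empty (length (encodeInstance I)) adjacent? σ ≤-refl n≡0
  ...   | i , us , run =
    stay-put n≡0 , (λ S* _ → foldr-⊔-least _ λ p → absurd (σ p)) ,
    subst Outputs (encode-constant {v = 0} σ (λ p → absurd (σ p))) (i , [] , us , run)
    where
    absurd : ∀ {A : Set} → Fin n → A
    absurd u = ⊥-elim (¬Fin0 (subst Fin n≡0 u))
  approximate | no n≢0
    -- The search takes radii as successors, so `n` is passed as `suc (pred n)`, with vertex 0 as a
    -- center that is good there. The unary `n` in the input keeps this radius within the input
    -- length.
    with Runs.Input.program-run (length (encodeInstance I)) adjacent? σ ≤-refl (pred n) 0<n
           (≤-trans (≤-reflexive 1+pred) (Runs.Input.n≤X _ adjacent? σ ≤-refl))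
           (0 , 0<n , subst₂ (λ r v → good r v ≡ true) (sym 1+pred) (toℕ-fromℕ< 0<n) (good-n (fromℕ< 0<n)))
    where
    0<n = n≢0⇒n>0 n≢0
    1+pred : suc (pred n) ≡ n
    1+pred = suc-pred n {{≢-nonZero n≢0}}
  ... | best , i , us , run =
    gather c , (λ S* _ → gather-bound c S* (trans (cong (good (suc radius)) c≡) is-good) minimal) ,
    subst Outputs (encode-constant {k} (λ _ → c) (λ _ → c≡)) (i , [] , us , run)
    where
    open Runs.Input.Best best
    center<n′ : center < n
    center<n′ = ≤-trans (m≤m+n _ rest) (≤-reflexive (trans (sym (+-suc center rest)) center<n))
    c = fromℕ< center<n′
    c≡ : toℕ c ≡ center
    c≡ = toℕ-fromℕ< center<n′

theorem10 : SolvableInPolyTime encodeInstance encodeSolution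
    (λ I μ̃ → ∀ (μ* : Solution I) → IsOptimal I μ* → Max I μ̃ ≤ Max I μ* + 1)
theorem10 = solvable program (λ I → nonempty (Instance.n I)) Approximation.approximate
  where
  nonempty : ∀ m {z} → 0 < length (unary m ++ z)
  nonempty zero    = s≤s z≤n
  nonempty (suc m) = s≤s z≤n
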